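{- Let $\Bbbk^\bullet$ be a set of forcing commands closed under anti-$\to_\bullet$-evaluation. For every MAL formula $C$, every positive propositional domain $\mathcal D^{\oplus\bullet}$ (for the countdown interpretation, containing all sets $\|\mathcal C[p]\|^\bullet$), every total valuation $\rho^\bullet$, every closed term $t$ and every $p\in\mathbb N$, $$t\in\|C^*(\mathbf p)\|^\bullet_{\rho^\bullet}\iff(t,p)\in\|C\|^\circ_{\rho^\circ}.$$ Here $\|C^*(\mathbf p)\|^\bullet_{\rho^\bullet}$ is the countdown-machine realizability interpretation of the forcing translation $C^*$ at the numeral $\mathbf p$, and $\|C\|^\circ_{\rho^\circ}$ is the quantitative realizability interpretation of $C$ over the monoid $\mathbb N$ with pole $\Bbbk^\circ$ and valuation $\rho^\circ$ induced by $\Bbbk^\bullet$ and $\rho^\bullet$.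
   Context: **Terms.** Positive variables $x,\dots$, negative variables $\alpha,\dots$, $\kappa,\kappa'$ of either polarity. Positive values $V_+::=x\mid (V,V')\mid\{V\}\mid\overline n\ (n\in\mathbb N)\mid k_+$ (other constants); values $V::=V_+\mid t_-$; positive terms $t_+::=V_+\mid\mu\alpha.c$; negative terms $t_-::=\alpha\mid\mu(\kappa,\kappa').c\ (\kappa\neq\kappa')\mid\mu\{\kappa\}.c\mid\mu x.c\mid k_-$; commands $c::=\langle t_+|t_-\rangle$ with $\langle t|u\rangle$ and $\langle u|t\rangle$ identified. Pairs/one-tuples $(t,u)$, $\{t\}$ of non-values, should they occur, are abbreviations for $\mu\alpha.\langle t|\mu\kappa.\langle u|\mu\kappa'.\langle(\kappa,\kappa')|\alpha\rangle\rangle\rangle$, $\mu\alpha.\langle t|\mu\kappa.\langle\{\kappa\}|\alpha\rangle\rangle$. **Countdown machine.** A negative command is $\langle t^\ominus|u_+\rangle$ with $t$ a term of either polarity and $u_+$ a positive term ($\ominus$ is just a mark). A forcing command is a negative command $\langle t^\ominus|(u,K)\rangle$, also written $\langle t^\ominus|u\rangle\{K\}$, where $K$ is a term and $t,u$ are terms of opposite polarities; $\langle t^\ominus|u\rangle\{K\}$ and $\langle u^\ominus|t\rangle\{K\}$ are identified. For a command $c=\langle t_+|u_-\rangle$, $c^\bullet\{K\}=\langle u_-^\ominus|(t_+,K)\rangle$. Reduction $\to_\bullet$: $\langle t_-^\ominus|\mu\alpha.c\rangle\{\overline n\}\to_\bullet(c[t_-/\alpha])^\bullet\{\overline n\}$;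 $\langle(\mu x.c)^\ominus|V_+\rangle\{\overline n\}\to_\bullet(c[V_+/x])^\bullet\{\overline n\}$; $\langle(\mu(\kappa,\kappa').c)^\ominus|(V_1,V_2)\rangle\{\overline{n+1}\}\to_\bullet(c[V_1/\kappa,V_2/\kappa'])^\bullet\{\overline n\}$; $\langle(\mu\{\kappa\}.c)^\ominus|\{V\}\rangle\{\overline{n+1}\}\to_\bullet(c[V/\kappa])^\bullet\{\overline n\}$; the last two redexes with counter $\overline0$ diverge. Closed under anti-evaluation: $c\to_\bullet c'$ and $c'\in\Bbbk^\bullet$ imply $c\in\Bbbk^\bullet$. **Countdown interpretation.** Let $\Bbbk^\bullet_0=\{\langle t_+|u_-\rangle:\langle u_-^\ominus|t_+\rangle\in\Bbbk^\bullet\}$. Closed terms $t_+$ (positive) and $u_-$ (negative) are orthogonal if $\langle t_+|u_-\rangle\in\Bbbk^\bullet_0$; for a set $X$ of closed terms of one polarity, $X^\bot$ is the set of closed terms of the other polarity orthogonal to all elements of $X$. $X\otimes Y=\{(t,u):t\in X,u\in Y\}$, $\downarrow X=\{\{t\}:t\in X\}$. A positive propositional domain $\mathcal D^{\oplus\bullet}$ is a set of sets of closed positive values, closed under unions and intersections of families and such that $X\otimes Y,\downarrow X\in\mathcal D^{\oplus\bullet}$ for all $X,Y\in\mathcal D^{\oplus\bullet}\cup\{Z^\bot:Z\in\mathcal D^{\oplus\bullet}\}$; it is assumed to contain each set $\|\mathcal C[p]\|^\bullet=\{\overline n:n\in\mathbb N,\ p\le n\}$, $p\in\mathbb N$, which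 interprets a positive predicate constant $\mathcal C[\cdot]:\iota\to o^+$ ($\iota$ is the kind of natural numbers, $o^\pm$ the kinds of positive/negative formulas). A total valuation $\rho^\bullet$ assigns in particular to each variable $X^{\iota\to o^+}$ a function $\mathbb N\to\mathcal D^{\oplus\bullet}$. Formulas are interpreted by: $\|A\otimes B\|^\bullet=\|A\|^\bullet\otimes\|B\|^\bullet$; $\|\downarrow A\|^\bullet=\downarrow\|A\|^\bullet$; $\|\exists r.A\|^\bullet=\bigcup_{r\in\mathbb N}\|A\|^\bullet$ for $A$ positive. The equational implication $\langle T=U\rangle A$ (informally "$T\cong U$ implies $A$", of the same polarity as $A$) is interpreted as $A$ is if $T\cong U$ (i.e. $T$ and $U$ are convertible: they denote the same number), and by $\emptyset^\bot$ (all closed terms of the polarity of $A$) otherwise. A negative formula $N$ (built with $\wp,\uparrow,\forall$) is interpreted by orthogonality: $t\in\|N\|^\bullet$ iff $\langle t^\ominus|u\rangle\in\Bbbk^\bullet$ for every $u\in\|N^\bot\|^\bullet$, where $t$ is a closed term that need not be negative. **MAL and forcing translation.** MAL formulas: $A,B::=P\mid N$; $P::=X\mid A\otimes B\mid\downarrow A$; $N::=X^\bot\mid A\wp B\mid\uparrow A$, with the usual De Morgan involutive negation ($\otimes/\wp$, $\downarrow/\uparrow$, $X/X^\bot$). For a predicate $Z$ on $\iota$, its forcing orthogonal is $\overline Z=\lambda r.\forall r'.\,Z(r')\multimap\mathcal C[r+r']^\bot$, with $A\multimap B=A^\bot\wp B$; thus $\|\overline Z(\mathbf p)\|^\bullet$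 is the set of closed $t$ such that $\langle t^\ominus|(u,K)\rangle\in\Bbbk^\bullet$ for all $r\in\mathbb N$, $u\in\|Z(\mathbf r)\|^\bullet$, $K\in\|\mathcal C[p+r]\|^\bullet$. The translation: $X^*=X^{\iota\to o^+}$; $(X^\bot)^*=\overline{X^{\iota\to o^+}}$; $(A\otimes B)^*=\lambda r.\exists p_1.\exists p_2.\langle r=p_1+p_2\rangle(A^*(p_1)\otimes B^*(p_2))$; $(A\wp B)^*=\overline{\lambda r.\exists p_1.\exists p_2.\langle r=p_1+p_2\rangle((A^\bot)^*(p_1)\otimes(B^\bot)^*(p_2))}$; $(\downarrow A)^*=\lambda r.\downarrow A^*(r)$; $(\uparrow A)^*=\overline{\lambda r.\downarrow(A^\bot)^*(r)}$. $\mathbf p$ is the numeral of $p$. **Induced quantitative interpretation.** $\Bbbk^\circ=\{(c,p):c\text{ closed command},\ p\in\mathbb N,\ \forall K\in\|\mathcal C[p]\|^\bullet,\ c^\bullet\{K\}\in\Bbbk^\bullet\}$; $\rho^\circ(X)=\{(t,p):t\in\rho^\bullet(X^{\iota\to o^+})(p)\}$. A closed positive weighted term $(t_+,p)$ and a closed negative weighted term $(t_-,q)$ ($p,q\in\mathbb N$) are orthogonal if $(\langle t_+|t_-\rangle,p+q)\in\Bbbk^\circ$; for a set $X$ of positive (resp. negative) weighted terms, $X^\bot$ is the set of negative (resp. positive) weighted terms orthogonal to every element of $X$. $\|X\|^\circ=\rho^\circ(X)$; $\|X^\bot\|^\circ=\rho^\circ(X)^\bot$; $\|A\otimes B\|^\circ=\{((t,u),p+q):(t,p)\in\|A\|^\circ,(u,q)\in\|B\|^\circ\}$;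 $\|\downarrow A\|^\circ=\{(\{t\},p):(t,p)\in\|A\|^\circ\}$; $\|A\wp B\|^\circ=(\|A^\bot\otimes B^\bot\|^\circ)^\bot$; $\|\uparrow A\|^\circ=(\|\downarrow A^\bot\|^\circ)^\bot$ (all with valuation $\rho^\circ$).
   Formalization: For positive A, ⟨T=U⟩A with T≇U is interpreted by ∅ instead of all closed positive terms; a negative formula is realized only by negative terms, and t has the polarity of C. Otherwise C=X⊗X (empty pole) and C=X^⊥ (t positive), with ρ(X)=∅, refute the claim. -}

module Defs where

open import Level using (Level; 0ℓ; _⊔_) renaming (suc to lsuc)
open import Data.Nat.Base using (ℕ; zero; suc; _≤_) renaming (_+_ to _+ℕ_)
open import Data.Fin.Base using (Fin; zero; suc)
open import Data.Vec.Base using (Vec; []; _∷_; lookup)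
open import Data.List.Base using (List; []; _∷_)
open import Data.List.Relation.Unary.Any using (here; there)
open import Data.List.Membership.Propositional using () renaming (_∈_ to _∈ˡ_)
open import Data.List.Relation.Binary.Subset.Propositional using (_⊆_)
open import Data.Maybe.Base using (Maybe; just; nothing)
open import Data.Product.Base using (∃-syntax; _×_; _,_; proj₁; proj₂)
open import Function.Bundles using (_⇔_)
open import Relation.Binary.PropositionalEquality using (_≡_; refl; cong; cong₂)
open import Relation.Unary using (Pred; _∈_; _≐_) renaming (_⊆_ to _⊆ᵖ_)

data Pol : Set where
  pos neg : Pol

opp : Pol → Pol
opp pos = neg
opp neg = pos

------------------------------------------------------------------------
-- Terms

-- Well-scoped de Bruijn syntax: a context lists the polarities of its
-- variables, so the two variables bound by μ(κ,κ') are distinct by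
-- construction.

Ctx : Set
Ctx = List Pol

-- K pos and K neg are the sets of positive and negative constants.

data Val (K : Pol → Set) (Γ : Ctx) : Pol → Set
data Tm  (K : Pol → Set) (Γ : Ctx) : Pol → Set
data Cmd (K : Pol → Set) (Γ : Ctx) : Set

data Val K Γ where
  var  : pos ∈ˡ Γ → Val K Γ pos
  pair : ∀ {ε δ} → Val K Γ ε → Val K Γ δ → Val K Γ pos
  one  : ∀ {ε} → Val K Γ ε → Val K Γ pos
  num  : ℕ → Val K Γ pos
  con  : K pos → Val K Γ pos
  neg  : Tm K Γ neg → Val K Γ neg

data Tm K Γ where
  val  : Val K Γ pos → Tm K Γ pos
  μα_  : Cmd K (neg ∷ Γ) → Tm K Γ pos
  var  : neg ∈ˡ Γ → Tm K Γ neg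
  μ⟨⟩_ : ∀ {ε δ} → Cmd K (ε ∷ δ ∷ Γ) → Tm K Γ neg
  μ｛｝_ : ∀ {ε} → Cmd K (ε ∷ Γ) → Tm K Γ neg
  μx_  : Cmd K (pos ∷ Γ) → Tm K Γ neg
  con  : K neg → Tm K Γ neg

-- ⟨t|u⟩ and ⟨u|t⟩ being identified, the positive term comes first.

data Cmd K Γ where
  ⟨_∣_⟩ : Tm K Γ pos → Tm K Γ neg → Cmd K Γ

variable
  K       : Pol → Set
  Γ Δ     : Ctx
  ε δ κ   : Pol

varᵛ : ε ∈ˡ Γ → Val K Γ ε
varᵛ {ε = pos} x = var x
varᵛ {ε = neg} x = neg (var x)

⌊_⌋ : Val K Γ ε → Tm K Γ ε
⌊_⌋ {ε = pos} v       = val v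
⌊_⌋ {ε = neg} (neg t) = t

asVal : Tm K Γ ε → Maybe (Val K Γ ε)
asVal {ε = pos} (val v) = just v
asVal {ε = pos} (μα c)  = nothing
asVal {ε = neg} t       = just (neg t)

extʳ : Γ ⊆ Δ → (ε ∷ Γ) ⊆ (ε ∷ Δ)
extʳ ρ (here e)  = here e
extʳ ρ (there x) = there (ρ x)

renᵛ : Γ ⊆ Δ → Val K Γ ε → Val K Δ ε
renᵗ : Γ ⊆ Δ → Tm K Γ ε → Tm K Δ ε
renᶜ : Γ ⊆ Δ → Cmd K Γ → Cmd K Δ

renᵛ ρ (var x)    = var (ρ x)
renᵛ ρ (pair v w) = pair (renᵛ ρ v) (renᵛ ρ w)
renᵛ ρ (one v)    = one (renᵛ ρ v)
renᵛ ρ (num n)    = num n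
renᵛ ρ (con k)    = con k
renᵛ ρ (neg t)    = neg (renᵗ ρ t)

renᵗ ρ (val v)  = val (renᵛ ρ v)
renᵗ ρ (μα c)   = μα (renᶜ (extʳ ρ) c)
renᵗ ρ (var x)  = var (ρ x)
renᵗ ρ (μ⟨⟩ c)  = μ⟨⟩ (renᶜ (extʳ (extʳ ρ)) c)
renᵗ ρ (μ｛｝ c) = μ｛｝ (renᶜ (extʳ ρ) c)
renᵗ ρ (μx c)   = μx (renᶜ (extʳ ρ) c)
renᵗ ρ (con k)  = con k

renᶜ ρ ⟨ t ∣ u ⟩ = ⟨ renᵗ ρ t ∣ renᵗ ρ u ⟩

Sub : (Pol → Set) → Ctx → Ctx → Set
Sub K Γ Δ = ∀ {ε} → ε ∈ˡ Γ → Val K Δ ε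

extˢ : Sub K Γ Δ → Sub K (ε ∷ Γ) (ε ∷ Δ)
extˢ σ (here e)  = varᵛ (here e)
extˢ σ (there x) = renᵛ there (σ x)

subᵛ : Sub K Γ Δ → Val K Γ ε → Val K Δ ε
subᵗ : Sub K Γ Δ → Tm K Γ ε → Tm K Δ ε
subᶜ : Sub K Γ Δ → Cmd K Γ → Cmd K Δ

subᵛ σ (var x)    = σ x
subᵛ σ (pair v w) = pair (subᵛ σ v) (subᵛ σ w)
subᵛ σ (one v)    = one (subᵛ σ v)
subᵛ σ (num n)    = num n
subᵛ σ (con k)    = con k
subᵛ σ (neg t)    = neg (subᵗ σ t)

subᵗ σ (val v)  = val (subᵛ σ v)
subᵗ σ (μα c)   = μα (subᶜ (extˢ σ) c)
subᵗ σ (var x)  = ⌊ σ x ⌋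
subᵗ σ (μ⟨⟩ c)  = μ⟨⟩ (subᶜ (extˢ (extˢ σ)) c)
subᵗ σ (μ｛｝ c) = μ｛｝ (subᶜ (extˢ σ) c)
subᵗ σ (μx c)   = μx (subᶜ (extˢ σ) c)
subᵗ σ (con k)  = con k

subᶜ σ ⟨ t ∣ u ⟩ = ⟨ subᵗ σ t ∣ subᵗ σ u ⟩

_∷ˢ_ : Val K Δ ε → Sub K Γ Δ → Sub K (ε ∷ Γ) Δ
(v ∷ˢ σ) (here refl) = v
(v ∷ˢ σ) (there x)   = σ x

_[_] : Cmd K (ε ∷ Γ) → Val K Γ ε → Cmd K Γ
c [ v ] = subᶜ (v ∷ˢ varᵛ) c

_[_؛_] : Cmd K (ε ∷ δ ∷ Γ) → Val K Γ ε → Val K Γ δ → Cmd K Γ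
c [ v ؛ w ] = subᶜ (v ∷ˢ (w ∷ˢ varᵛ)) c

-- ⟨t|μκ.c⟩, with κ of the polarity of t

bind : Tm K Γ ε → Cmd K (ε ∷ Γ) → Cmd K Γ
bind {ε = pos} t c = ⟨ t ∣ μx c ⟩
bind {ε = neg} t c = ⟨ μα c ∣ t ⟩

-- (t,u) and {t} for arbitrary terms: the value when the components are
-- values, and otherwise the abbreviations
--   μα.⟨t|μκ.⟨u|μκ'.⟨(κ,κ')|α⟩⟩⟩   and   μα.⟨t|μκ.⟨{κ}|α⟩⟩.

pairᵐ : Tm K Γ ε → Tm K Γ δ → Maybe (Val K Γ ε) → Maybe (Val K Γ δ) → Tm K Γ pos
pairᵐ t u (just v) (just w) = val (pair v w)
pairᵐ t u _        _        =
  μα (bind (renᵗ there t)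
     (bind (renᵗ (λ x → there (there x)) u)
     ⟨ val (pair (varᵛ (there (here refl))) (varᵛ (here refl)))
     ∣ var (there (there (here refl))) ⟩))

pairᵗ : Tm K Γ ε → Tm K Γ δ → Tm K Γ pos
pairᵗ t u = pairᵐ t u (asVal t) (asVal u)

oneᵐ : Tm K Γ ε → Maybe (Val K Γ ε) → Tm K Γ pos
oneᵐ t (just v) = val (one v)
oneᵐ t nothing  =
  μα (bind (renᵗ there t)
     ⟨ val (one (varᵛ (here refl))) ∣ var (there (here refl)) ⟩)

oneᵗ : Tm K Γ ε → Tm K Γ pos
oneᵗ t = oneᵐ t (asVal t)

------------------------------------------------------------------------
-- The countdown machine

-- Closed negative commands ⟨t^⊖|u₊⟩.

record NegCmd (K : Pol → Set) : Set where
  constructor ⟨_⊖∣_⟩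
  field
    {polarity} : Pol
    left       : Tm K [] polarity
    right      : Tm K [] pos

-- ⟨t^⊖|u⟩{K} is the negative command ⟨t^⊖|(u,K)⟩.

⟨_⊖∣_⟩｛_｝ : Tm K [] ε → Tm K [] δ → Tm K [] κ → NegCmd K
⟨ t ⊖∣ u ⟩｛ k ｝ = ⟨ t ⊖∣ pairᵗ u k ⟩

data IsForcing {K} : Pred (NegCmd K) 0ℓ where
  forcing⁻ : (t : Tm K [] neg) (u : Tm K [] pos) (k : Tm K [] κ) →
             IsForcing ⟨ t ⊖∣ u ⟩｛ k ｝
  forcing⁺ : (t : Tm K [] pos) (u : Tm K [] neg) (k : Tm K [] κ) →
             IsForcing ⟨ t ⊖∣ u ⟩｛ k ｝

_∙｛_｝ : Cmd K [] → Tm K [] κ → NegCmd K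
⟨ t ∣ u ⟩ ∙｛ k ｝ = ⟨ u ⊖∣ t ⟩｛ k ｝

n̲ : ℕ → Tm K [] pos
n̲ n = val (num n)

infix 4 _⟶_

data _⟶_ {K} : NegCmd K → NegCmd K → Set where
  red-μα : (t : Tm K [] neg) (c : Cmd K (neg ∷ [])) (n : ℕ) →
    ⟨ t ⊖∣ μα c ⟩｛ n̲ n ｝ ⟶ (c [ neg t ]) ∙｛ n̲ n ｝
  red-μx : (c : Cmd K (pos ∷ [])) (v : Val K [] pos) (n : ℕ) →
    ⟨ μx c ⊖∣ val v ⟩｛ n̲ n ｝ ⟶ (c [ v ]) ∙｛ n̲ n ｝
  red-μ⟨⟩ : (c : Cmd K (ε ∷ δ ∷ [])) (v : Val K [] ε) (w : Val K [] δ) (n : ℕ) →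
    ⟨ μ⟨⟩ c ⊖∣ val (pair v w) ⟩｛ n̲ (suc n) ｝ ⟶ (c [ v ؛ w ]) ∙｛ n̲ n ｝
  red-μ｛｝ : (c : Cmd K (ε ∷ [])) (v : Val K [] ε) (n : ℕ) →
    ⟨ μ｛｝ c ⊖∣ val (one v) ⟩｛ n̲ (suc n) ｝ ⟶ (c [ v ]) ∙｛ n̲ n ｝

-- The field `swap` is the identification of ⟨t^⊖|u⟩{K} with ⟨u^⊖|t⟩{K}.

record IsPole {K} (𝕜 : Pred (NegCmd K) 0ℓ) : Set where
  field
    forcing : 𝕜 ⊆ᵖ IsForcing
    swap    : (t : Tm K [] pos) (u : Tm K [] neg) (k : Tm K [] κ) →
              ⟨ u ⊖∣ t ⟩｛ k ｝ ∈ 𝕜 ⇔ ⟨ t ⊖∣ u ⟩｛ k ｝ ∈ 𝕜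
    anti    : ∀ {c c′} → c ⟶ c′ → c′ ∈ 𝕜 → c ∈ 𝕜

------------------------------------------------------------------------
-- Sets of closed terms of one polarity

TermSet : (Pol → Set) → Pol → Set₁
TermSet K ε = Pred (Tm K [] ε) 0ℓ

IsValue : TermSet K pos
IsValue t = ∃[ v ] t ≡ val v

infixr 6 _⊗ˢ_

_⊗ˢ_ : TermSet K ε → TermSet K δ → TermSet K pos
(X ⊗ˢ Y) s = ∃[ t ] ∃[ u ] s ≡ pairᵗ t u × t ∈ X × u ∈ Y

↓ˢ : TermSet K ε → TermSet K pos
↓ˢ X s = ∃[ t ] s ≡ oneᵗ t × t ∈ X

𝒞ˢ : ℕ → TermSet K pos
𝒞ˢ p t = ∃[ n ] t ≡ n̲ n × p ≤ n

module Countdown {K} (𝕜 : Pred (NegCmd K) 0ℓ) where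

  𝕜₀ : Pred (Cmd K []) 0ℓ
  𝕜₀ ⟨ t ∣ u ⟩ = ⟨ u ⊖∣ t ⟩ ∈ 𝕜

  _⊥ˢ : TermSet K ε → TermSet K (opp ε)
  _⊥ˢ {ε = pos} X u = ∀ t → t ∈ X → ⟨ t ∣ u ⟩ ∈ 𝕜₀
  _⊥ˢ {ε = neg} X t = ∀ u → u ∈ X → ⟨ t ∣ u ⟩ ∈ 𝕜₀

  -- 𝒟 ∪ { Z^⊥ : Z ∈ 𝒟 }

  data _∪⊥ {d} (𝒟 : Pred (TermSet K pos) d) : ∀ {ε} → TermSet K ε → Set (lsuc 0ℓ ⊔ d) where
    dom  : ∀ {Z} → 𝒟 Z → (𝒟 ∪⊥) Z
    orth : ∀ {Z} → 𝒟 Z → (𝒟 ∪⊥) (Z ⊥ˢ)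

  -- `resp` is extensionality of sets.

  record IsPositiveDomain {d} (𝒟 : Pred (TermSet K pos) d) : Set (lsuc 0ℓ ⊔ d) where
    field
      resp     : ∀ {X Y} → X ≐ Y → 𝒟 X → 𝒟 Y
      values   : ∀ {X} → 𝒟 X → X ⊆ᵖ IsValue
      ⋃-closed : (I : Set) (F : I → TermSet K pos) → (∀ i → 𝒟 (F i)) →
                 𝒟 (λ t → ∃[ i ] t ∈ F i)
      ⋂-closed : (I : Set) (F : I → TermSet K pos) → (∀ i → 𝒟 (F i)) →
                 𝒟 (λ t → t ∈ IsValue × (∀ i → t ∈ F i))
      ⊗-closed : ∀ {ε δ} {X : TermSet K ε} {Y : TermSet K δ} →
                 (𝒟 ∪⊥) X → (𝒟 ∪⊥) Y → 𝒟 (X ⊗ˢ Y)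
      ↓-closed : ∀ {ε} {X : TermSet K ε} → (𝒟 ∪⊥) X → 𝒟 (↓ˢ X)
      𝒞-closed : ∀ p → 𝒟 (𝒞ˢ p)

------------------------------------------------------------------------
-- Formulas interpreted on the countdown machine

-- First-order expressions of kind ι and formulas, over Θ variables of
-- kind ι and a set 𝒳 of predicate variables of kind ι → o⁺.

data Num (Θ : ℕ) : Set where
  var : Fin Θ → Num Θ
  lit : ℕ → Num Θ
  _⊞_ : Num Θ → Num Θ → Num Θ

variable
  Θ : ℕ
  𝒳 : Set

wk : Num Θ → Num (suc Θ)
wk (var i) = var (suc i)
wk (lit n) = lit n
wk (T ⊞ U) = wk T ⊞ wk U

eval : Num Θ → Vec ℕ Θ → ℕ
eval (var i) η = lookup η i
eval (lit n) η = n
eval (T ⊞ U) η = eval T η +ℕ eval U η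

infixr 6 _⊗_ _⅋_
infixr 5 _⊸_

data Fm (𝒳 : Set) (Θ : ℕ) : Pol → Set where
  var   : 𝒳 → Num Θ → Fm 𝒳 Θ pos
  𝒞     : Num Θ → Fm 𝒳 Θ pos
  _⊗_   : Fm 𝒳 Θ ε → Fm 𝒳 Θ δ → Fm 𝒳 Θ pos
  ↓_    : Fm 𝒳 Θ ε → Fm 𝒳 Θ pos
  ∃′    : Fm 𝒳 (suc Θ) pos → Fm 𝒳 Θ pos
  var⊥  : 𝒳 → Num Θ → Fm 𝒳 Θ neg
  𝒞⊥    : Num Θ → Fm 𝒳 Θ neg
  _⅋_   : Fm 𝒳 Θ ε → Fm 𝒳 Θ δ → Fm 𝒳 Θ neg
  ↑_    : Fm 𝒳 Θ ε → Fm 𝒳 Θ neg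
  ∀′    : Fm 𝒳 (suc Θ) neg → Fm 𝒳 Θ neg
  ⟨_≗_⟩_ : Num Θ → Num Θ → Fm 𝒳 Θ ε → Fm 𝒳 Θ ε

_ᶠ⊥ : Fm 𝒳 Θ ε → Fm 𝒳 Θ (opp ε)
var X T ᶠ⊥       = var⊥ X T
𝒞 T ᶠ⊥           = 𝒞⊥ T
(A ⊗ B) ᶠ⊥       = (A ᶠ⊥) ⅋ (B ᶠ⊥)
(↓ A) ᶠ⊥         = ↑ (A ᶠ⊥)
∃′ A ᶠ⊥          = ∀′ (A ᶠ⊥)
var⊥ X T ᶠ⊥      = var X T
𝒞⊥ T ᶠ⊥          = 𝒞 T
(A ⅋ B) ᶠ⊥       = (A ᶠ⊥) ⊗ (B ᶠ⊥)
(↑ A) ᶠ⊥         = ↓ (A ᶠ⊥)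
∀′ A ᶠ⊥          = ∃′ (A ᶠ⊥)
(⟨ T ≗ U ⟩ A) ᶠ⊥ = ⟨ T ≗ U ⟩ (A ᶠ⊥)

_⊸_ : Fm 𝒳 Θ ε → Fm 𝒳 Θ δ → Fm 𝒳 Θ neg
A ⊸ B = (A ᶠ⊥) ⅋ B

-- Interpretation of ⟨T=U⟩A, where E says that T and U denote the same
-- number.  When E fails, a negative formula is interpreted by ∅^⊥, the set
-- of all closed negative terms, and a positive one by ∅.  The second clause
-- is dual to the first, negative formulas being interpreted by the
-- orthogonal of their negation, and it makes ∃p₁.∃p₂.⟨r=p₁+p₂⟩A the union
-- of the interpretations of A over the decompositions of r.  With all
-- closed positive terms instead of ∅, that union would contain every closed
-- positive term, whatever A.

guard : Set → TermSet K ε → TermSet K ε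
guard {ε = pos} E X t = E × t ∈ X
guard {ε = neg} E X t = E → t ∈ X

-- ∥ A ∥ and ∥ A ⊥∥ interpret A and its negation (see ∥⊥∥-correct).  They
-- are defined together because the recursion through _ᶠ⊥ is not structural.
-- A negative formula is interpreted by the orthogonal of its negation, as a
-- set of negative terms: when that negation is interpreted by ∅, a positive
-- term would satisfy the defining condition vacuously, and ↓ and ⊗ would
-- then be applied to sets of terms of both polarities.

module Interpretation {K} (𝕜 : Pred (NegCmd K) 0ℓ) (ρ : 𝒳 → ℕ → TermSet K pos) where
  open Countdown 𝕜

  ∥_∥  : Fm 𝒳 Θ ε → Vec ℕ Θ → TermSet K ε
  ∥_⊥∥ : Fm 𝒳 Θ ε → Vec ℕ Θ → TermSet K (opp ε)

  ∥ var X T ∥ η       = ρ X (eval T η)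
  ∥ 𝒞 T ∥ η           = 𝒞ˢ (eval T η)
  ∥ A ⊗ B ∥ η         = ∥ A ∥ η ⊗ˢ ∥ B ∥ η
  ∥ ↓ A ∥ η           = ↓ˢ (∥ A ∥ η)
  ∥ ∃′ A ∥ η t        = ∃[ r ] t ∈ ∥ A ∥ (r ∷ η)
  ∥ var⊥ X T ∥ η      = ρ X (eval T η) ⊥ˢ
  ∥ 𝒞⊥ T ∥ η          = 𝒞ˢ (eval T η) ⊥ˢ
  ∥ A ⅋ B ∥ η         = (∥ A ⊥∥ η ⊗ˢ ∥ B ⊥∥ η) ⊥ˢ
  ∥ ↑ A ∥ η           = ↓ˢ (∥ A ⊥∥ η) ⊥ˢ
  ∥ ∀′ A ∥ η          = (λ t → ∃[ r ] t ∈ ∥ A ⊥∥ (r ∷ η)) ⊥ˢ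
  ∥ ⟨ T ≗ U ⟩ A ∥ η   = guard (eval T η ≡ eval U η) (∥ A ∥ η)

  ∥ var X T ⊥∥ η      = ρ X (eval T η) ⊥ˢ
  ∥ 𝒞 T ⊥∥ η          = 𝒞ˢ (eval T η) ⊥ˢ
  ∥ A ⊗ B ⊥∥ η        = (∥ A ∥ η ⊗ˢ ∥ B ∥ η) ⊥ˢ
  ∥ ↓ A ⊥∥ η          = ↓ˢ (∥ A ∥ η) ⊥ˢ
  ∥ ∃′ A ⊥∥ η         = (λ t → ∃[ r ] t ∈ ∥ A ∥ (r ∷ η)) ⊥ˢ
  ∥ var⊥ X T ⊥∥ η     = ρ X (eval T η)
  ∥ 𝒞⊥ T ⊥∥ η         = 𝒞ˢ (eval T η)
  ∥ A ⅋ B ⊥∥ η        = ∥ A ⊥∥ η ⊗ˢ ∥ B ⊥∥ η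
  ∥ ↑ A ⊥∥ η          = ↓ˢ (∥ A ⊥∥ η)
  ∥ ∀′ A ⊥∥ η t       = ∃[ r ] t ∈ ∥ A ⊥∥ (r ∷ η)
  ∥ ⟨ T ≗ U ⟩ A ⊥∥ η  = guard (eval T η ≡ eval U η) (∥ A ⊥∥ η)

------------------------------------------------------------------------
-- MAL and its forcing translation

data MAL (𝒳 : Set) : Pol → Set where
  var  : 𝒳 → MAL 𝒳 pos
  _⊗_  : MAL 𝒳 ε → MAL 𝒳 δ → MAL 𝒳 pos
  ↓_   : MAL 𝒳 ε → MAL 𝒳 pos
  var⊥ : 𝒳 → MAL 𝒳 neg
  _⅋_  : MAL 𝒳 ε → MAL 𝒳 δ → MAL 𝒳 neg
  ↑_   : MAL 𝒳 ε → MAL 𝒳 neg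

_⊥ : MAL 𝒳 ε → MAL 𝒳 (opp ε)
var X ⊥   = var⊥ X
(A ⊗ B) ⊥ = (A ⊥) ⅋ (B ⊥)
(↓ A) ⊥   = ↑ (A ⊥)
var⊥ X ⊥  = var X
(A ⅋ B) ⊥ = (A ⊥) ⊗ (B ⊥)
(↑ A) ⊥   = ↓ (A ⊥)

-- Predicates of kind ι → o^ε without free variables of kind ι, given by
-- their instances: λr.A is a function of the argument r.

Predicate : Set → Pol → Set
Predicate 𝒳 ε = ∀ {Θ} → Num Θ → Fm 𝒳 Θ ε

forb : Predicate 𝒳 ε → Predicate 𝒳 neg
forb Z r = ∀′ (Z r′ ⊸ 𝒞⊥ (wk r ⊞ r′))
  where r′ = var zero

_⊗*_ : Predicate 𝒳 ε → Predicate 𝒳 δ → Predicate 𝒳 pos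
(Z ⊗* W) r = ∃′ (∃′ (⟨ wk (wk r) ≗ p₁ ⊞ p₂ ⟩ (Z p₁ ⊗ W p₂)))
  where p₁ = var (suc zero)
        p₂ = var zero

↓* : Predicate 𝒳 ε → Predicate 𝒳 pos
↓* Z r = ↓ Z r

-- ⟪ A ⟫* is A* and ⟪ A ⊥⟫* is (A^⊥)* (see ⟪⊥⟫*-correct).

⟪_⟫*  : MAL 𝒳 ε → Predicate 𝒳 ε
⟪_⊥⟫* : MAL 𝒳 ε → Predicate 𝒳 (opp ε)

⟪ var X ⟫*   = var X
⟪ A ⊗ B ⟫*   = ⟪ A ⟫* ⊗* ⟪ B ⟫*
⟪ ↓ A ⟫*     = ↓* ⟪ A ⟫*
⟪ var⊥ X ⟫*  = forb (var X)
⟪ A ⅋ B ⟫*   = forb (⟪ A ⊥⟫* ⊗* ⟪ B ⊥⟫*)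
⟪ ↑ A ⟫*     = forb (↓* ⟪ A ⊥⟫*)

⟪ var X ⊥⟫*  = forb (var X)
⟪ A ⊗ B ⊥⟫*  = forb (⟪ A ⟫* ⊗* ⟪ B ⟫*)
⟪ ↓ A ⊥⟫*    = forb (↓* ⟪ A ⟫*)
⟪ var⊥ X ⊥⟫* = var X
⟪ A ⅋ B ⊥⟫*  = ⟪ A ⊥⟫* ⊗* ⟪ B ⊥⟫*
⟪ ↑ A ⊥⟫*    = ↓* ⟪ A ⊥⟫*

------------------------------------------------------------------------
-- Quantitative interpretation of MAL

WTermSet : (Pol → Set) → Pol → Set₁
WTermSet K ε = Pred (Tm K [] ε × ℕ) 0ℓ

_⊗ʷ_ : WTermSet K ε → WTermSet K δ → WTermSet K pos
(X ⊗ʷ Y) (s , r) = ∃[ t ] ∃[ p ] ∃[ u ] ∃[ q ]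
  (s ≡ pairᵗ t u × r ≡ p +ℕ q × (t , p) ∈ X × (u , q) ∈ Y)

↓ʷ : WTermSet K ε → WTermSet K pos
↓ʷ X (s , p) = ∃[ t ] (s ≡ oneᵗ t × (t , p) ∈ X)

module Quantitative {K} (𝕜° : Pred (Cmd K [] × ℕ) 0ℓ) (ρ° : 𝒳 → WTermSet K pos) where

  _⊥ʷ : WTermSet K ε → WTermSet K (opp ε)
  _⊥ʷ {ε = pos} X (u , q) = ∀ t p → (t , p) ∈ X → (⟨ t ∣ u ⟩ , p +ℕ q) ∈ 𝕜°
  _⊥ʷ {ε = neg} X (t , p) = ∀ u q → (u , q) ∈ X → (⟨ t ∣ u ⟩ , p +ℕ q) ∈ 𝕜°

  -- ∥ A ⊥∥° interprets A ⊥ (see ∥⊥∥°-correct).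

  ∥_∥°  : MAL 𝒳 ε → WTermSet K ε
  ∥_⊥∥° : MAL 𝒳 ε → WTermSet K (opp ε)

  ∥ var X ∥°   = ρ° X
  ∥ A ⊗ B ∥°   = ∥ A ∥° ⊗ʷ ∥ B ∥°
  ∥ ↓ A ∥°     = ↓ʷ ∥ A ∥°
  ∥ var⊥ X ∥°  = ρ° X ⊥ʷ
  ∥ A ⅋ B ∥°   = (∥ A ⊥∥° ⊗ʷ ∥ B ⊥∥°) ⊥ʷ
  ∥ ↑ A ∥°     = ↓ʷ ∥ A ⊥∥° ⊥ʷ

  ∥ var X ⊥∥°  = ρ° X ⊥ʷ
  ∥ A ⊗ B ⊥∥°  = (∥ A ∥° ⊗ʷ ∥ B ∥°) ⊥ʷ
  ∥ ↓ A ⊥∥°    = ↓ʷ ∥ A ∥° ⊥ʷ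
  ∥ var⊥ X ⊥∥° = ρ° X
  ∥ A ⅋ B ⊥∥°  = ∥ A ⊥∥° ⊗ʷ ∥ B ⊥∥°
  ∥ ↑ A ⊥∥°    = ↓ʷ ∥ A ⊥∥°

-- The pole and the valuation induced by those of the countdown machine.

induced-pole : Pred (NegCmd K) 0ℓ → Pred (Cmd K [] × ℕ) 0ℓ
induced-pole 𝕜 (c , p) = ∀ k → k ∈ 𝒞ˢ p → c ∙｛ k ｝ ∈ 𝕜

induced-valuation : (𝒳 → ℕ → TermSet K pos) → 𝒳 → WTermSet K pos
induced-valuation ρ X (t , p) = t ∈ ρ X p

------------------------------------------------------------------------
-- The clauses for negations agree with those for the negated formulas

-- opp is involutive at each polarity, but not definitionally.

unopp : ∀ {a} (F : Pol → Set a) ε → F (opp (opp ε)) → F ε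
unopp F pos x = x
unopp F neg x = x

module _ {𝒳 : Set} where

  private
    infix 4 _≋_
    _≋_ : ∀ {ε} → Predicate 𝒳 ε → Predicate 𝒳 ε → Set
    Z ≋ W = ∀ {Θ} (r : Num Θ) → Z r ≡ W r

    infix 4 _≋²_
    _≋²_ : ∀ {ε} → Predicate 𝒳 (opp (opp ε)) → Predicate 𝒳 ε → Set
    _≋²_ {ε} Z W = ∀ {Θ} (r : Num Θ) → unopp (Fm 𝒳 Θ) ε (Z r) ≡ W r

    forb-cong : (Z W : Predicate 𝒳 pos) → Z ≋ W → forb Z ≋ forb W
    forb-cong Z W h r = cong (λ A → ∀′ (A ⊸ 𝒞⊥ (wk r ⊞ var zero))) (h (var zero))

    ⊗*-cong : (Z Z′ : Predicate 𝒳 ε) (W W′ : Predicate 𝒳 δ) →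
              Z ≋ Z′ → W ≋ W′ → Z ⊗* W ≋ Z′ ⊗* W′
    ⊗*-cong Z Z′ W W′ h k r =
      cong₂ (λ A B → ∃′ (∃′ (⟨ wk (wk r) ≗ var (suc zero) ⊞ var zero ⟩ (A ⊗ B)))) (h _) (k _)

    ↓*-cong : (Z Z′ : Predicate 𝒳 ε) → Z ≋ Z′ → ↓* Z ≋ ↓* Z′
    ↓*-cong Z Z′ h r = cong ↓_ (h r)

    ⊗*-cong² : ∀ ε δ (Z : Predicate 𝒳 (opp (opp ε))) (Z′ : Predicate 𝒳 ε)
                     (W : Predicate 𝒳 (opp (opp δ))) (W′ : Predicate 𝒳 δ) →
               Z ≋² Z′ → W ≋² W′ → Z ⊗* W ≋ Z′ ⊗* W′
    ⊗*-cong² pos pos = ⊗*-cong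
    ⊗*-cong² pos neg = ⊗*-cong
    ⊗*-cong² neg pos = ⊗*-cong
    ⊗*-cong² neg neg = ⊗*-cong

    ↓*-cong² : ∀ ε (Z : Predicate 𝒳 (opp (opp ε))) (Z′ : Predicate 𝒳 ε) →
               Z ≋² Z′ → ↓* Z ≋ ↓* Z′
    ↓*-cong² pos = ↓*-cong
    ↓*-cong² neg = ↓*-cong

  ⟪⊥⟫*-correct  : (A : MAL 𝒳 ε) (r : Num Θ) → ⟪ A ⊥ ⟫* r ≡ ⟪ A ⊥⟫* r
  ⟪⊥⊥⟫*-correct : (A : MAL 𝒳 ε) (r : Num Θ) → unopp (Fm 𝒳 Θ) ε (⟪ A ⊥ ⊥⟫* r) ≡ ⟪ A ⟫* r

  ⟪⊥⟫*-correct (var X)  r = refl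
  ⟪⊥⟫*-correct (_⊗_ {ε} {δ} A B) r =
    forb-cong _ (⟪ A ⟫* ⊗* ⟪ B ⟫*)
      (⊗*-cong² ε δ ⟪ A ⊥ ⊥⟫* ⟪ A ⟫* ⟪ B ⊥ ⊥⟫* ⟪ B ⟫* (⟪⊥⊥⟫*-correct A) (⟪⊥⊥⟫*-correct B)) r
  ⟪⊥⟫*-correct (↓_ {ε} A) r =
    forb-cong _ (↓* ⟪ A ⟫*) (↓*-cong² ε ⟪ A ⊥ ⊥⟫* ⟪ A ⟫* (⟪⊥⊥⟫*-correct A)) r
  ⟪⊥⟫*-correct (var⊥ X) r = refl
  ⟪⊥⟫*-correct (A ⅋ B)  r =
    ⊗*-cong ⟪ A ⊥ ⟫* ⟪ A ⊥⟫* ⟪ B ⊥ ⟫* ⟪ B ⊥⟫* (⟪⊥⟫*-correct A) (⟪⊥⟫*-correct B) r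
  ⟪⊥⟫*-correct (↑ A)    r = ↓*-cong ⟪ A ⊥ ⟫* ⟪ A ⊥⟫* (⟪⊥⟫*-correct A) r

  ⟪⊥⊥⟫*-correct (var X)  r = refl
  ⟪⊥⊥⟫*-correct (_⊗_ {ε} {δ} A B) r =
    ⊗*-cong² ε δ ⟪ A ⊥ ⊥⟫* ⟪ A ⟫* ⟪ B ⊥ ⊥⟫* ⟪ B ⟫* (⟪⊥⊥⟫*-correct A) (⟪⊥⊥⟫*-correct B) r
  ⟪⊥⊥⟫*-correct (↓_ {ε} A) r = ↓*-cong² ε ⟪ A ⊥ ⊥⟫* ⟪ A ⟫* (⟪⊥⊥⟫*-correct A) r
  ⟪⊥⊥⟫*-correct (var⊥ X) r = refl
  ⟪⊥⊥⟫*-correct (A ⅋ B)  r =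
    forb-cong _ (⟪ A ⊥⟫* ⊗* ⟪ B ⊥⟫*)
      (⊗*-cong ⟪ A ⊥ ⟫* ⟪ A ⊥⟫* ⟪ B ⊥ ⟫* ⟪ B ⊥⟫* (⟪⊥⟫*-correct A) (⟪⊥⟫*-correct B)) r
  ⟪⊥⊥⟫*-correct (↑ A)    r =
    forb-cong _ (↓* ⟪ A ⊥⟫*) (↓*-cong ⟪ A ⊥ ⟫* ⟪ A ⊥⟫* (⟪⊥⟫*-correct A)) r

module _ {K} {𝒳 : Set} (𝜋 : Pred (Cmd K [] × ℕ) 0ℓ) (ρ° : 𝒳 → WTermSet K pos) where

  open Quantitative 𝜋 ρ°

  private
    ⊗ʷ-cong² : ∀ ε δ {X : WTermSet K (opp (opp ε))} {X′ : WTermSet K ε}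
                     {Y : WTermSet K (opp (opp δ))} {Y′ : WTermSet K δ} →
               unopp (WTermSet K) ε X ≡ X′ → unopp (WTermSet K) δ Y ≡ Y′ → X ⊗ʷ Y ≡ X′ ⊗ʷ Y′
    ⊗ʷ-cong² pos pos refl refl = refl
    ⊗ʷ-cong² pos neg refl refl = refl
    ⊗ʷ-cong² neg pos refl refl = refl
    ⊗ʷ-cong² neg neg refl refl = refl

    ↓ʷ-cong² : ∀ ε {X : WTermSet K (opp (opp ε))} {X′ : WTermSet K ε} →
               unopp (WTermSet K) ε X ≡ X′ → ↓ʷ X ≡ ↓ʷ X′
    ↓ʷ-cong² pos refl = refl
    ↓ʷ-cong² neg refl = refl

  ∥⊥∥°-correct  : (A : MAL 𝒳 ε) → ∥ A ⊥ ∥° ≡ ∥ A ⊥∥°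
  ∥⊥⊥∥°-correct : (A : MAL 𝒳 ε) → unopp (WTermSet K) ε ∥ A ⊥ ⊥∥° ≡ ∥ A ∥°

  ∥⊥∥°-correct (var X)           = refl
  ∥⊥∥°-correct (_⊗_ {ε} {δ} A B) = cong _⊥ʷ (⊗ʷ-cong² ε δ (∥⊥⊥∥°-correct A) (∥⊥⊥∥°-correct B))
  ∥⊥∥°-correct (↓_ {ε} A)        = cong _⊥ʷ (↓ʷ-cong² ε (∥⊥⊥∥°-correct A))
  ∥⊥∥°-correct (var⊥ X)          = refl
  ∥⊥∥°-correct (A ⅋ B)           = cong₂ _⊗ʷ_ (∥⊥∥°-correct A) (∥⊥∥°-correct B)
  ∥⊥∥°-correct (↑ A)             = cong ↓ʷ (∥⊥∥°-correct A)

  ∥⊥⊥∥°-correct (var X)           = refl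
  ∥⊥⊥∥°-correct (_⊗_ {ε} {δ} A B) = ⊗ʷ-cong² ε δ (∥⊥⊥∥°-correct A) (∥⊥⊥∥°-correct B)
  ∥⊥⊥∥°-correct (↓_ {ε} A)        = ↓ʷ-cong² ε (∥⊥⊥∥°-correct A)
  ∥⊥⊥∥°-correct (var⊥ X)          = refl
  ∥⊥⊥∥°-correct (A ⅋ B)           = cong _⊥ʷ (cong₂ _⊗ʷ_ (∥⊥∥°-correct A) (∥⊥∥°-correct B))
  ∥⊥⊥∥°-correct (↑ A)             = cong _⊥ʷ (cong ↓ʷ (∥⊥∥°-correct A))

module _ {K} {𝒳 : Set} (𝕜 : Pred (NegCmd K) 0ℓ) (ρ : 𝒳 → ℕ → TermSet K pos) where

  open Countdown 𝕜
  open Interpretation 𝕜 ρ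

  private
    ≐-refl : {X : TermSet K ε} → X ≐ X
    ≐-refl = (λ x → x) , (λ x → x)

    ⊥ˢ-cong : {X Y : TermSet K ε} → X ≐ Y → X ⊥ˢ ≐ Y ⊥ˢ
    ⊥ˢ-cong {ε = pos} (f , g) = (λ h t x → h t (g x)) , (λ h t x → h t (f x))
    ⊥ˢ-cong {ε = neg} (f , g) = (λ h t x → h t (g x)) , (λ h t x → h t (f x))

    ⊗ˢ-cong : {X X′ : TermSet K ε} {Y Y′ : TermSet K δ} →
              X ≐ X′ → Y ≐ Y′ → X ⊗ˢ Y ≐ X′ ⊗ˢ Y′
    ⊗ˢ-cong (f , g) (h , k) =
      (λ (t , u , e , x , y) → t , u , e , f x , h y) ,
      (λ (t , u , e , x , y) → t , u , e , g x , k y)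

    ↓ˢ-cong : {X X′ : TermSet K ε} → X ≐ X′ → ↓ˢ X ≐ ↓ˢ X′
    ↓ˢ-cong (f , g) = (λ (t , e , x) → t , e , f x) , (λ (t , e , x) → t , e , g x)

    ∃-cong : {X Y : ℕ → TermSet K pos} → (∀ r → X r ≐ Y r) →
             (λ t → ∃[ r ] t ∈ X r) ≐ (λ t → ∃[ r ] t ∈ Y r)
    ∃-cong h = (λ (r , x) → r , proj₁ (h r) x) , (λ (r , x) → r , proj₂ (h r) x)

    guard-cong : ∀ E {X Y : TermSet K ε} → X ≐ Y → guard E X ≐ guard E Y
    guard-cong {ε = pos} E (f , g) = (λ (e , x) → e , f x) , (λ (e , x) → e , g x)
    guard-cong {ε = neg} E (f , g) = (λ x e → f (x e)) , (λ x e → g (x e))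

    ⊗ˢ-cong² : ∀ ε δ {X : TermSet K (opp (opp ε))} {X′ : TermSet K ε}
                     {Y : TermSet K (opp (opp δ))} {Y′ : TermSet K δ} →
               unopp (TermSet K) ε X ≐ X′ → unopp (TermSet K) δ Y ≐ Y′ → X ⊗ˢ Y ≐ X′ ⊗ˢ Y′
    ⊗ˢ-cong² pos pos = ⊗ˢ-cong
    ⊗ˢ-cong² pos neg = ⊗ˢ-cong
    ⊗ˢ-cong² neg pos = ⊗ˢ-cong
    ⊗ˢ-cong² neg neg = ⊗ˢ-cong

    ↓ˢ-cong² : ∀ ε {X : TermSet K (opp (opp ε))} {X′ : TermSet K ε} →
               unopp (TermSet K) ε X ≐ X′ → ↓ˢ X ≐ ↓ˢ X′
    ↓ˢ-cong² pos = ↓ˢ-cong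
    ↓ˢ-cong² neg = ↓ˢ-cong

    guard-cong² : ∀ ε E {X : TermSet K (opp (opp ε))} {Y : TermSet K ε} →
                  unopp (TermSet K) ε X ≐ Y → unopp (TermSet K) ε (guard E X) ≐ guard E Y
    guard-cong² pos E = guard-cong E
    guard-cong² neg E = guard-cong E

  ∥⊥∥-correct  : (A : Fm 𝒳 Θ ε) (η : Vec ℕ Θ) → ∥ A ᶠ⊥ ∥ η ≐ ∥ A ⊥∥ η
  ∥⊥⊥∥-correct : (A : Fm 𝒳 Θ ε) (η : Vec ℕ Θ) → unopp (TermSet K) ε (∥ A ᶠ⊥ ⊥∥ η) ≐ ∥ A ∥ η

  ∥⊥∥-correct (var X T)         η = ≐-refl
  ∥⊥∥-correct (𝒞 T)             η = ≐-refl
  ∥⊥∥-correct (_⊗_ {ε} {δ} A B) η = ⊥ˢ-cong (⊗ˢ-cong² ε δ (∥⊥⊥∥-correct A η) (∥⊥⊥∥-correct B η))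
  ∥⊥∥-correct (↓_ {ε} A)        η = ⊥ˢ-cong (↓ˢ-cong² ε (∥⊥⊥∥-correct A η))
  ∥⊥∥-correct (∃′ A)            η = ⊥ˢ-cong (∃-cong (λ r → ∥⊥⊥∥-correct A (r ∷ η)))
  ∥⊥∥-correct (var⊥ X T)        η = ≐-refl
  ∥⊥∥-correct (𝒞⊥ T)            η = ≐-refl
  ∥⊥∥-correct (A ⅋ B)           η = ⊗ˢ-cong (∥⊥∥-correct A η) (∥⊥∥-correct B η)
  ∥⊥∥-correct (↑ A)             η = ↓ˢ-cong (∥⊥∥-correct A η)
  ∥⊥∥-correct (∀′ A)            η = ∃-cong (λ r → ∥⊥∥-correct A (r ∷ η))
  ∥⊥∥-correct (⟨ T ≗ U ⟩ A)     η = guard-cong _ (∥⊥∥-correct A η)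

  ∥⊥⊥∥-correct (var X T)         η = ≐-refl
  ∥⊥⊥∥-correct (𝒞 T)             η = ≐-refl
  ∥⊥⊥∥-correct (_⊗_ {ε} {δ} A B) η = ⊗ˢ-cong² ε δ (∥⊥⊥∥-correct A η) (∥⊥⊥∥-correct B η)
  ∥⊥⊥∥-correct (↓_ {ε} A)        η = ↓ˢ-cong² ε (∥⊥⊥∥-correct A η)
  ∥⊥⊥∥-correct (∃′ A)            η = ∃-cong (λ r → ∥⊥⊥∥-correct A (r ∷ η))
  ∥⊥⊥∥-correct (var⊥ X T)        η = ≐-refl
  ∥⊥⊥∥-correct (𝒞⊥ T)            η = ≐-refl
  ∥⊥⊥∥-correct (A ⅋ B)           η = ⊥ˢ-cong (⊗ˢ-cong (∥⊥∥-correct A η) (∥⊥∥-correct B η))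
  ∥⊥⊥∥-correct (↑ A)             η = ⊥ˢ-cong (↓ˢ-cong (∥⊥∥-correct A η))
  ∥⊥⊥∥-correct (∀′ A)            η = ⊥ˢ-cong (∃-cong (λ r → ∥⊥∥-correct A (r ∷ η)))
  ∥⊥⊥∥-correct {ε = ε} (⟨ T ≗ U ⟩ A) η = guard-cong² ε _ (∥⊥⊥∥-correct A η)

{-# OPTIONS --safe #-}
-- Both interpretations have the same clauses for the positive connectives, up to
-- the choice of a decomposition r = p₁ + p₂.  For a negative formula, t belongs
-- to the forcing orthogonal of Z at q iff ⟨t^⊖|(u,k)⟩ is in the pole for all n,
-- u ∈ Z(n) and k ≥ q + n, which is the weighted orthogonality of (t,q) to every
-- (u,n) with respect to the induced pole.  An induction on formulas concludes.
module Submission where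

open import Defs
open import Level using (Level; 0ℓ)
open import Data.Nat.Base using (ℕ) renaming (_+_ to _+ℕ_)
open import Data.Nat.Properties using (+-comm)
open import Data.Fin.Base using (zero; suc)
open import Data.List.Base using ([])
open import Data.Vec.Base using (Vec; []; _∷_)
open import Data.Product.Base using (_,_; proj₁; proj₂)
open import Function.Bundles using (_⇔_; mk⇔; Equivalence)
open import Relation.Binary.PropositionalEquality using (_≡_; refl; sym; trans; cong; cong₂; subst)
open import Relation.Unary using (Pred; _∈_)

eval-wk : (T : Num Θ) (n : ℕ) (η : Vec ℕ Θ) → eval (wk T) (n ∷ η) ≡ eval T η
eval-wk (var i) n η = refl
eval-wk (lit m) n η = refl
eval-wk (T ⊞ U) n η = cong₂ _+ℕ_ (eval-wk T n η) (eval-wk U n η)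

module _ {K} {𝒳 : Set} (𝕜 : Pred (NegCmd K) 0ℓ) (ρ : 𝒳 → ℕ → TermSet K pos) where

  open Interpretation 𝕜 ρ
  open Quantitative (induced-pole 𝕜) (induced-valuation ρ)
  open Equivalence

  infix 4 _≈°_

  -- Open arguments `r` and all environments are covered because `⊗*` and `forb` apply their
  -- predicates to variables bound by quantifiers.
  _≈°_ : Predicate 𝒳 ε → WTermSet K ε → Set
  Z ≈° X = ∀ {Θ} (r : Num Θ) (η : Vec ℕ Θ) {t} → t ∈ ∥ Z r ∥ η ⇔ (t , eval r η) ∈ X

  ⊗*-≈° : (Z : Predicate 𝒳 ε) (W : Predicate 𝒳 δ) (X : WTermSet K ε) (Y : WTermSet K δ) →
          Z ≈° X → W ≈° Y → Z ⊗* W ≈° X ⊗ʷ Y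
  ⊗*-≈° Z W X Y Z≈X W≈Y r η = mk⇔
    (λ (m , n , e , t , u , s≡ , z , w) →
      t , m , u , n , s≡ , trans (sym (eval-wk² m n)) e ,
      to (Z≈X p₁ (n ∷ m ∷ η)) z , to (W≈Y p₂ (n ∷ m ∷ η)) w)
    (λ (t , m , u , n , s≡ , e , x , y) →
      m , n , trans (eval-wk² m n) e , t , u , s≡ ,
      from (Z≈X p₁ (n ∷ m ∷ η)) x , from (W≈Y p₂ (n ∷ m ∷ η)) y)
    where
    p₁ = var (suc zero)
    p₂ = var zero
    eval-wk² : ∀ m n → eval (wk (wk r)) (n ∷ m ∷ η) ≡ eval r η
    eval-wk² m n = trans (eval-wk (wk r) n (m ∷ η)) (eval-wk r m η)

  ↓*-≈° : (Z : Predicate 𝒳 ε) (X : WTermSet K ε) → Z ≈° X → ↓* Z ≈° ↓ʷ X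
  ↓*-≈° Z X Z≈X r η = mk⇔
    (λ (t , s≡ , z) → t , s≡ , to (Z≈X r η) z)
    (λ (t , s≡ , x) → t , s≡ , from (Z≈X r η) x)

  -- By definition `⟨ t ∣ u ⟩ ∙｛ k ｝` is `⟨ u ⊖∣ pairᵗ t k ⟩`, so both sides quantify over the same
  -- commands.
  forb-≈° : (Z : Predicate 𝒳 pos) (X : WTermSet K pos) → Z ≈° X → forb Z ≈° X ⊥ʷ
  forb-≈° Z X Z≈X r η = mk⇔
    (λ h t n x k k∈ → h (pairᵗ t k)
      (n , t , k , refl ,
       -- `⊸` negates `Z r′` and the clause for `∀′` negates again; this removes the double
       -- negation.
       proj₂ (∥⊥⊥∥-correct 𝕜 ρ (Z r′) (n ∷ η)) (from (Z≈X r′ (n ∷ η)) x) ,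
       subst (λ m → k ∈ 𝒞ˢ m) (sym (bound n)) k∈))
    (λ { h _ (n , t , k , refl , z , k∈) → h t n
      (to (Z≈X r′ (n ∷ η)) (proj₁ (∥⊥⊥∥-correct 𝕜 ρ (Z r′) (n ∷ η)) z))
      k (subst (λ m → k ∈ 𝒞ˢ m) (bound n) k∈) })
    where
    r′ = var zero
    -- `forb` writes its own argument first in the counter's lower bound, `⊥ʷ` the weight of the
    -- positive term.
    bound : ∀ n → eval (wk r) (n ∷ η) +ℕ n ≡ n +ℕ eval r η
    bound n = trans (cong (_+ℕ n) (eval-wk r n η)) (+-comm (eval r η) n)

  var-≈° : (X : 𝒳) → var X ≈° induced-valuation ρ X
  var-≈° X r η = mk⇔ (λ x → x) (λ x → x)

  -- The clauses for `⅋` and `↑` refer to the negations of subformulas, hence a simultaneous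
  -- induction for a formula and its negation.
  ⟪⟫*-≈°  : (A : MAL 𝒳 ε) → ⟪ A ⟫* ≈° ∥ A ∥°
  ⟪⊥⟫*-≈° : (A : MAL 𝒳 ε) → ⟪ A ⊥⟫* ≈° ∥ A ⊥∥°

  ⟪⟫*-≈° (var X)  = var-≈° X
  ⟪⟫*-≈° (A ⊗ B)  = ⊗*-≈° ⟪ A ⟫* ⟪ B ⟫* ∥ A ∥° ∥ B ∥° (⟪⟫*-≈° A) (⟪⟫*-≈° B)
  ⟪⟫*-≈° (↓ A)    = ↓*-≈° ⟪ A ⟫* ∥ A ∥° (⟪⟫*-≈° A)
  ⟪⟫*-≈° (var⊥ X) = forb-≈° (var X) (induced-valuation ρ X) (var-≈° X)
  ⟪⟫*-≈° (A ⅋ B)  = forb-≈° (⟪ A ⊥⟫* ⊗* ⟪ B ⊥⟫*) (∥ A ⊥∥° ⊗ʷ ∥ B ⊥∥°)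
    (⊗*-≈° ⟪ A ⊥⟫* ⟪ B ⊥⟫* ∥ A ⊥∥° ∥ B ⊥∥° (⟪⊥⟫*-≈° A) (⟪⊥⟫*-≈° B))
  ⟪⟫*-≈° (↑ A)    = forb-≈° (↓* ⟪ A ⊥⟫*) (↓ʷ ∥ A ⊥∥°) (↓*-≈° ⟪ A ⊥⟫* ∥ A ⊥∥° (⟪⊥⟫*-≈° A))

  ⟪⊥⟫*-≈° (var X)  = forb-≈° (var X) (induced-valuation ρ X) (var-≈° X)
  ⟪⊥⟫*-≈° (A ⊗ B)  = forb-≈° (⟪ A ⟫* ⊗* ⟪ B ⟫*) (∥ A ∥° ⊗ʷ ∥ B ∥°)
    (⊗*-≈° ⟪ A ⟫* ⟪ B ⟫* ∥ A ∥° ∥ B ∥° (⟪⟫*-≈° A) (⟪⟫*-≈° B))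
  ⟪⊥⟫*-≈° (↓ A)    = forb-≈° (↓* ⟪ A ⟫*) (↓ʷ ∥ A ∥°) (↓*-≈° ⟪ A ⟫* ∥ A ∥° (⟪⟫*-≈° A))
  ⟪⊥⟫*-≈° (var⊥ X) = var-≈° X
  ⟪⊥⟫*-≈° (A ⅋ B)  = ⊗*-≈° ⟪ A ⊥⟫* ⟪ B ⊥⟫* ∥ A ⊥∥° ∥ B ⊥∥° (⟪⊥⟫*-≈° A) (⟪⊥⟫*-≈° B)
  ⟪⊥⟫*-≈° (↑ A)    = ↓*-≈° ⟪ A ⊥⟫* ∥ A ⊥∥° (⟪⊥⟫*-≈° A)

lemma89 : {d : Level} {K : Pol → Set} {𝒳 : Set} {ε : Pol}
    (𝕜 : Pred (NegCmd K) 0ℓ) → IsPole 𝕜 →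
    (C : MAL 𝒳 ε)
    (𝒟 : Pred (TermSet K pos) d) → Countdown.IsPositiveDomain 𝕜 𝒟 →
    (ρ : 𝒳 → ℕ → TermSet K pos) → (∀ X n → 𝒟 (ρ X n)) →
    (t : Tm K [] ε) (p : ℕ) →
    t ∈ Interpretation.∥_∥ 𝕜 ρ (⟪ C ⟫* (lit p)) []
    ⇔
    (t , p) ∈ Quantitative.∥_∥° (induced-pole 𝕜) (induced-valuation ρ) C
-- `eval (lit p) []` computes to `p`.
lemma89 𝕜 _ C _ _ ρ _ t p = ⟪⟫*-≈° 𝕜 ρ C (lit p) []
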